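{- Let $G=(V,E)$ be a graph and $v\in V$. Then $v\in \mathrm{anticore}(G)$ if and only if $\gamma(G_v+u)=\gamma(G)+1$.
   Context: All graphs are finite, simple and undirected. A set $S\subseteq V$ is dominating if every vertex of $V$ is in $S$ or adjacent to a vertex of $S$; $\gamma(G)$ is the minimum size of a dominating set, and a minimum dominating set (mds, or $\gamma$-set) is a dominating set of size $\gamma(G)$. $\mathrm{core}(G)$ is the set of vertices belonging to every mds of $G$, $\mathrm{corona}(G)$ is the set of vertices belonging to at least one mds of $G$, and $\mathrm{anticore}(G)=V\setminus \mathrm{corona}(G)$. For $v\in V$, $G_v+u$ denotes the graph obtained from $G$ by adding one new vertex $u$ and the single edge $uv$. -}

module Defs where

open import Data.Empty using (⊥)
open import Data.Fin using (Fin; zero; suc)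
open import Data.Fin.Properties using (_≟_; any?; all?)
open import Data.Fin.Subset using (Subset; _∈_; ∣_∣; ⊤)
open import Data.Fin.Subset.Properties using (_∈?_; ∈⊤; anySubset?)
open import Data.Nat using (ℕ; suc; _≤_; _<_; _<?_)
open import Data.Nat.Induction using (Acc; acc; <-wellFounded)
open import Data.Nat.Properties using (≮⇒≥)
open import Data.Product using (_×_; _,_; ∃; proj₁; proj₂)
open import Data.Sum using (_⊎_; inj₁)
open import Level using (0ℓ)
open import Relation.Binary using (Rel; Symmetric; Irreflexive; Decidable)
open import Relation.Binary.PropositionalEquality using (_≡_; refl)
open import Relation.Nullary using (Dec; yes; no; ¬_)
open import Relation.Nullary.Decidable using (_×-dec_; _⊎-dec_)
open import Relation.Unary using (Pred; ∁)

-- Finite simple undirected graphs on the vertex set Fin n.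
record Graph (n : ℕ) : Set₁ where
  field
    Adj    : Rel (Fin n) 0ℓ
    sym    : Symmetric Adj
    irrefl : Irreflexive _≡_ Adj
    adj?   : Decidable Adj

module _ {n : ℕ} (G : Graph n) where
  open Graph G

  Dominating : Pred (Subset n) 0ℓ
  Dominating S = ∀ x → x ∈ S ⊎ (∃ λ y → y ∈ S × Adj x y)

  dominating? : ∀ S → Dec (Dominating S)
  dominating? S =
    all? λ x → (x ∈? S) ⊎-dec any? (λ y → (y ∈? S) ×-dec adj? x y)

  HasMinimumSize : Pred (Subset n) 0ℓ
  HasMinimumSize S = ∀ T → Dominating T → ∣ S ∣ ≤ ∣ T ∣

  private
    shrink : ∀ S → Dominating S → Acc _<_ ∣ S ∣ →
             ∃ λ T → Dominating T × HasMinimumSize T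
    shrink S dom (acc rec)
      with anySubset? (λ T → dominating? T ×-dec (∣ T ∣ <? ∣ S ∣))
    ... | yes (T , domT , T<S) = shrink T domT (rec T<S)
    ... | no  none = S , dom , λ T domT → ≮⇒≥ (λ T<S → none (T , domT , T<S))

  minimumDominating : ∃ λ S → Dominating S × HasMinimumSize S
  minimumDominating = shrink ⊤ (λ _ → inj₁ ∈⊤) (<-wellFounded _)

  γ : ℕ
  γ = ∣ proj₁ minimumDominating ∣

  γ-attained : ∃ λ S → Dominating S × ∣ S ∣ ≡ γ
  γ-attained = proj₁ minimumDominating , proj₁ (proj₂ minimumDominating) , refl

  γ-minimum : ∀ S → Dominating S → γ ≤ ∣ S ∣
  γ-minimum = proj₂ (proj₂ minimumDominating)

  MinimumDominating : Pred (Subset n) 0ℓ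
  MinimumDominating S = Dominating S × ∣ S ∣ ≡ γ

  corona : Pred (Fin n) 0ℓ
  corona x = ∃ λ S → MinimumDominating S × x ∈ S

  anticore : Pred (Fin n) 0ℓ
  anticore = ∁ corona

-- The graph G_v+u: the new vertex u is zero, and each old vertex x becomes
-- suc x.
addPendant : ∀ {n} → Graph n → Fin n → Graph (suc n)
addPendant {n} G v = record
  { Adj    = Adj′
  ; sym    = λ {x} {y} → sym′ x y
  ; irrefl = λ { {x} refl → irrefl′ x }
  ; adj?   = adj′?
  }
  where
  open Graph G

  Adj′ : Rel (Fin (suc n)) 0ℓ
  Adj′ zero    zero    = ⊥
  Adj′ zero    (suc y) = y ≡ v
  Adj′ (suc x) zero    = x ≡ v
  Adj′ (suc x) (suc y) = Adj x y

  sym′ : ∀ x y → Adj′ x y → Adj′ y x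
  sym′ zero    (suc y) p = p
  sym′ (suc x) zero    p = p
  sym′ (suc x) (suc y) p = sym p

  irrefl′ : ∀ x → ¬ Adj′ x x
  irrefl′ (suc x) = irrefl refl

  adj′? : Decidable Adj′
  adj′? zero    zero    = no λ ()
  adj′? zero    (suc y) = y ≟ v
  adj′? (suc x) zero    = x ≟ v
  adj′? (suc x) (suc y) = adj? x y

{-# OPTIONS --safe #-}
-- Dominating sets of G_v+u correspond to dominating sets of G containing v:
-- replacing the pendant vertex u by v never increases the size, and a
-- dominating set of G containing v already dominates u.
module Submission where

open import Defs
open import Data.Fin using (Fin; zero; suc)
open import Data.Fin.Subset using (Subset; inside; outside; ∣_∣; _∪_; ⁅_⁆)
import Data.Fin.Subset as Subset
open import Data.Fin.Subset.Properties
  using (∣⁅x⁆∣≡1; p⊆p∪q; q⊆p∪q; x∈⁅x⁆)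
open import Data.Nat using (ℕ; suc; _+_; _≤_; z≤n; s≤s)
open import Data.Nat.Properties
  using (+-suc; +-comm; m≤n⇒m≤1+n; ≤-refl; ≤-reflexive; ≤-trans; ≤-antisym;
         ≰⇒>; m+1+n≰m; module ≤-Reasoning)
open import Data.Product using (∃; _×_; _,_)
open import Data.Sum using (inj₁; inj₂)
import Data.Sum as Sum
open import Data.Vec using ([]; _∷_; here; there)
open import Function.Bundles using (_⇔_; mk⇔)
open import Relation.Binary.PropositionalEquality
  using (_≡_; refl; sym; cong)
open import Relation.Unary using (_∈_)

∣p∪q∣≤∣p∣+∣q∣ : ∀ {n} (p q : Subset n) → ∣ p ∪ q ∣ ≤ ∣ p ∣ + ∣ q ∣
∣p∪q∣≤∣p∣+∣q∣ []            []            = z≤n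
∣p∪q∣≤∣p∣+∣q∣ (outside ∷ p) (outside ∷ q) = ∣p∪q∣≤∣p∣+∣q∣ p q
∣p∪q∣≤∣p∣+∣q∣ (inside  ∷ p) (outside ∷ q) = s≤s (∣p∪q∣≤∣p∣+∣q∣ p q)
∣p∪q∣≤∣p∣+∣q∣ (outside ∷ p) (inside  ∷ q)
  rewrite +-suc ∣ p ∣ ∣ q ∣ = s≤s (∣p∪q∣≤∣p∣+∣q∣ p q)
∣p∪q∣≤∣p∣+∣q∣ (inside  ∷ p) (inside  ∷ q)
  rewrite +-suc ∣ p ∣ ∣ q ∣ = s≤s (m≤n⇒m≤1+n (∣p∪q∣≤∣p∣+∣q∣ p q))

module _ {n} (G : Graph n) (v : Fin n) where

  -- The head bit of a subset records membership of `u`, which is `zero`; the tail is its trace on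
  -- the old vertices. Here `u` dominates itself.
  dominating-inside∷ : ∀ {S} → Dominating G S →
                       Dominating (addPendant G v) (inside ∷ S)
  dominating-inside∷ dom zero    = inj₁ here
  dominating-inside∷ dom (suc x) =
    Sum.map there (λ (y , y∈S , xy) → suc y , there y∈S , xy) (dom x)

  dominating-outside∷ : ∀ {S} → Dominating G S → v Subset.∈ S →
                        Dominating (addPendant G v) (outside ∷ S)
  dominating-outside∷ dom v∈S zero    = inj₂ (suc v , there v∈S , refl)
  dominating-outside∷ dom v∈S (suc x) =
    Sum.map there (λ (y , y∈S , xy) → suc y , there y∈S , xy) (dom x)

  -- Since `v` is the only neighbour of `u`, either `u` is outside `D` and `v` must lie in `D`, or
  -- `u` lies in `D` and `v` can take its place.
  dominating-contract : ∀ D → Dominating (addPendant G v) D →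
                        ∃ λ S → Dominating G S × v Subset.∈ S × ∣ S ∣ ≤ ∣ D ∣
  dominating-contract (outside ∷ T) dom = T , domT , v∈T , ≤-refl
    where
    v∈T : v Subset.∈ T
    v∈T with dom zero
    ... | inj₂ (suc _ , there v∈T , refl) = v∈T

    domT : Dominating G T
    domT x with dom (suc x)
    ... | inj₁ (there x∈T)              = inj₁ x∈T
    ... | inj₂ (suc y , there y∈T , xy) = inj₂ (y , y∈T , xy)
  dominating-contract (inside ∷ T) dom = T ∪ ⁅ v ⁆ , domS , v∈S , ∣S∣≤
    where
    v∈S : v Subset.∈ T ∪ ⁅ v ⁆
    v∈S = q⊆p∪q T ⁅ v ⁆ (x∈⁅x⁆ v)

    domS : Dominating G (T ∪ ⁅ v ⁆)
    domS x with dom (suc x)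
    ... | inj₁ (there x∈T)              = inj₁ (p⊆p∪q ⁅ v ⁆ x∈T)
    -- An old vertex dominated by `u` can only be `v`, which the union now contains.
    ... | inj₂ (zero  , _ , refl)       = inj₁ v∈S
    ... | inj₂ (suc y , there y∈T , xy) = inj₂ (y , p⊆p∪q ⁅ v ⁆ y∈T , xy)

    -- The `suc` counts `u`. The inequality is strict when `v` is already in `T`.
    ∣S∣≤ : ∣ T ∪ ⁅ v ⁆ ∣ ≤ suc ∣ T ∣
    ∣S∣≤ = begin
      ∣ T ∪ ⁅ v ⁆ ∣       ≤⟨ ∣p∪q∣≤∣p∣+∣q∣ T ⁅ v ⁆ ⟩
      ∣ T ∣ + ∣ ⁅ v ⁆ ∣   ≡⟨ cong (∣ T ∣ +_) (∣⁅x⁆∣≡1 v) ⟩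
      ∣ T ∣ + 1           ≡⟨ +-comm ∣ T ∣ 1 ⟩
      suc ∣ T ∣           ∎
      where open ≤-Reasoning

  -- Add `u` itself to a minimum dominating set of `G`; this holds for every `v`.
  γ-addPendant≤ : γ (addPendant G v) ≤ γ G + 1
  γ-addPendant≤ with S , dom , ∣S∣≡γ ← γ-attained G = begin
    γ (addPendant G v) ≤⟨ γ-minimum (addPendant G v) _ (dominating-inside∷ dom) ⟩
    suc ∣ S ∣          ≡⟨ cong suc ∣S∣≡γ ⟩
    suc (γ G)          ≡⟨ +-comm 1 (γ G) ⟩
    γ G + 1            ∎
    where open ≤-Reasoning

  corona⇒γ-addPendant≤ : v ∈ corona G → γ (addPendant G v) ≤ γ G
  corona⇒γ-addPendant≤ (S , (dom , ∣S∣≡γ) , v∈S) =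
    ≤-trans (γ-minimum (addPendant G v) _ (dominating-outside∷ dom v∈S))
            (≤-reflexive ∣S∣≡γ)

  -- Contracting a minimum dominating set of the larger graph gives a dominating set of `G` through
  -- `v` of size at most `γ G`, so it is minimum.
  γ-addPendant≤⇒corona : γ (addPendant G v) ≤ γ G → v ∈ corona G
  γ-addPendant≤⇒corona γH≤γG
    with D , domD , ∣D∣≡γH ← γ-attained (addPendant G v)
    with S , domS , v∈S , ∣S∣≤∣D∣ ← dominating-contract D domD =
    S , (domS , ≤-antisym ∣S∣≤γG (γ-minimum G S domS)) , v∈S
    where
    ∣S∣≤γG : ∣ S ∣ ≤ γ G
    ∣S∣≤γG = ≤-trans ∣S∣≤∣D∣ (≤-trans (≤-reflexive ∣D∣≡γH) γH≤γG)

theorem3 : ∀ {n : ℕ} (G : Graph n) (v : Fin n) →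
    (v ∈ anticore G) ⇔ (γ (addPendant G v) ≡ γ G + 1)
theorem3 G v = mk⇔
  -- The upper bound is unconditional; avoiding the corona forces a strict increase, which over the
  -- naturals is the matching lower bound.
  (λ v∉corona → ≤-antisym (γ-addPendant≤ G v)
    (≤-trans (≤-reflexive (+-comm (γ G) 1))
             (≰⇒> λ γH≤γG → v∉corona (γ-addPendant≤⇒corona G v γH≤γG))))
  -- A minimum dominating set through `v` would give `γ G + 1 ≤ γ G`.
  (λ γH≡γG+1 v∈corona → m+1+n≰m (γ G)
    (≤-trans (≤-reflexive (sym γH≡γG+1)) (corona⇒γ-addPendant≤ G v v∈corona)))
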